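{- Let $r,n$ be natural numbers and let $G$ be an Abelian group (written additively) with $|G|\ge r^2 n$. Then for every $r$-coloring $\chi:G\to\{1,\dots,r\}$ there exists a subset $A\subset G$ such that $A$ is monochromatic (i.e. $\chi$ is constant on $A$), $A$ is symmetric (i.e. $A=2g-A=\{2g-a:a\in A\}$ for some $g\in G$), and $|A|\ge n$.
   Context: An $r$-coloring of a set is a map from it to an $r$-element set of colors. A subset $A$ of an Abelian group $G$ is called symmetric if $A=2g-A$ for some $g\in G$ (in multiplicative notation, $A=gA^{ -1}g$). -}

module Defs where

open import Level using (Level; _⊔_)
open import Data.Nat using (ℕ)
open import Data.Fin using (Fin)
open import Data.Product using (Σ; ∃; _×_; _,_)
open import Function.Bundles using (_⇔_)
open import Algebra.Bundles using (AbelianGroup)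
open import Relation.Binary.PropositionalEquality using (_≡_)

module _ {c ℓ : Level} (G : AbelianGroup c ℓ) where
  open AbelianGroup G

  -- 2g - a, written with the (multiplicative) operations of the bundle
  reflectAt : Carrier → Carrier → Carrier
  reflectAt g a = (g ∙ g) ∙ (a ⁻¹)

  CardAtLeast : ℕ → Set (c ⊔ ℓ)
  CardAtLeast m = Σ (Fin m → Carrier) λ f → ∀ i j → f i ≈ f j → i ≡ j

  SubsetCardAtLeast : (Carrier → Set ℓ) → ℕ → Set (c ⊔ ℓ)
  SubsetCardAtLeast A m =
    Σ (Fin m → Carrier) λ f → (∀ i → A (f i)) × (∀ i j → f i ≈ f j → i ≡ j)

  Symmetric : (Carrier → Set ℓ) → Set (c ⊔ ℓ)
  Symmetric A = ∃ λ g → ∀ x → A x ⇔ (∃ λ a → A a × (x ≈ reflectAt g a))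

  Monochromatic : {r : ℕ} → (Carrier → Fin r) → (Carrier → Set ℓ) → Set (c ⊔ ℓ)
  Monochromatic {r} χ A = ∃ λ (k : Fin r) → ∀ x → A x → χ x ≡ k

  -- an r-coloring of G (a function on the setoid carrier, so it respects ≈)
  IsColoring : {r : ℕ} → (Carrier → Fin r) → Set (c ⊔ ℓ)
  IsColoring χ = ∀ {x y} → x ≈ y → χ x ≡ χ y

{-# OPTIONS --safe #-}

-- Equality in G is not decidable, so the argument only inspects colours. Let
-- e : Fin (r² n) → G be the given injection and pull χ back along
-- ℕ^(r² n) → G, c ↦ ∑ᵢ cᵢ eᵢ. For each i, test on a finite window of ℕ^(r² n)
-- whether some j ≤ N = 4 r² n makes χ invariant under translation by j eᵢ.
--
-- If no j works for some i, then j eᵢ ≉ 0 for 1 ≤ j ≤ N, so G contains a long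
-- injective arithmetic progression. Among the points 2x eᵢ with x < 2 r² n,
-- Cauchy–Schwarz gives many pairs of equal colour; two pigeonholes, over the
-- centre (x + y) eᵢ and the colour, leave n of them.
--
-- Otherwise χ agrees on the window with a colouring κ of the finite group
-- (ℤ/M)^(r² n), M = N!, of order h. Averaging over g the collisions of
-- u ↦ κ(g + 2u) gives a centre g and a colour k such that
-- S = {u : κ(g ± u) = k} has at least h / r² elements. Let P be the group of
-- periods of κ and p its order. S is a union of at least h / (r² p) cosets of
-- P, and colours show that points of distinct cosets are distinct in G. Some
-- coset of P contains the classes of at least r² n p / h of the eᵢ; translating
-- these into each coset of S yields n points of G, those within one coset being
-- distinct because e is injective.

module Submission where

open import Defs
open import Level using (Level; Lift; lift; lower)
open import Algebra.Bundles using (AbelianGroup)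
open import Data.Bool using (true; false; if_then_else_)
open import Data.Fin using (Fin; zero; suc; inject≤; remQuot; combine)
import Data.Fin as Fin
import Data.Fin.Properties as Fin
open import Data.List using (List; []; _∷_; _++_; _∷ʳ_; length; filter; lookup; allFin; upTo; cartesianProductWith)
import Data.List as List
open import Data.List.Properties using (map-cong; map-++; map-∘; map-tabulate; length-tabulate; length-upTo; upTo-∷ʳ; map-upTo; map-applyUpTo)
open import Data.List.Membership.Propositional using (_∈_; find)
open import Data.List.Membership.Propositional.Properties using (∈-lookup; ∈-upTo⁺; ∈-upTo⁻; ∈-filter⁺; ∈-filter⁻; ∈-cartesianProductWith⁺; ∈-cartesianProductWith⁻)
open import Data.List.Relation.Unary.Any using (here; there; any?)
import Data.List.Relation.Unary.All as All
open import Data.List.Relation.Unary.All.Properties using (¬Any⇒All¬)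
open import Data.List.Relation.Unary.AllPairs using (AllPairs; []; _∷_)
open import Data.List.Relation.Unary.Unique.Propositional using (Unique)
import Data.List.Relation.Unary.Unique.Propositional.Properties as Unique
open import Data.Nat
open import Data.Nat.DivMod using (m%n<n; m%n≤m; [m+kn]%n≡m%n; m≡m%n+[m/n]*n; m∣n⇒o%n%m≡o%m)
open import Data.Nat.Divisibility using (_∣_; ∣-trans; m∣m*n; m≤n⇒m!∣n!)
open import Data.Nat.ListAction using (sum)
open import Data.Nat.ListAction.Properties using (sum-++)
open import Data.Nat.Properties
open import Data.Nat.Tactic.RingSolver using (solve-∀)
open import Data.Product using (Σ; ∃; ∃₂; _×_; _,_; proj₁; proj₂; map₁; map₂; uncurry)
open import Data.Sum using (inj₁; inj₂)
open import Data.Vec using (Vec; []; _∷_; zipWith; map; replicate; updateAt)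
open import Data.Vec.Properties using (zipWith-comm; zipWith-assoc; zipWith-identityˡ; zipWith-identityʳ)
import Data.Vec.Relation.Unary.All as Vec
open import Function using (_∘_; id)
open import Function.Bundles using (mk⇔)
open import Relation.Binary using (Rel; Reflexive; tri<; tri≈; tri>)
import Relation.Binary as Binary
open import Relation.Binary.PropositionalEquality as ≡ using (_≡_; cong; cong₂; subst)
open import Relation.Nullary using (¬_; Dec; yes; no; does; contradiction; _×-dec_)
open import Relation.Nullary.Decidable using (map′)
open import Relation.Unary using (Pred; Decidable)

private variable
  a b p q : Level
  A : Set a
  B : Set b
  m : ℕ

-- Finite sums, averaging and the Cauchy-Schwarz inequality.

∑ : List A → (A → ℕ) → ℕ
∑ xs F = sum (List.map F xs)

infix 5 ∑
syntax ∑ xs (λ x → e) = ∑[ x ← xs ] e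

∑-cong : ∀ (xs : List A) {F G : A → ℕ} → (∀ x → F x ≡ G x) → ∑ xs F ≡ ∑ xs G
∑-cong xs F≗G = cong sum (map-cong F≗G xs)

∑-mono : ∀ (xs : List A) {F G : A → ℕ} → (∀ {x} → x ∈ xs → F x ≤ G x) → ∑ xs F ≤ ∑ xs G
∑-mono []       F≤G = z≤n
∑-mono (x ∷ xs) F≤G = +-mono-≤ (F≤G (here ≡.refl)) (∑-mono xs (F≤G ∘ there))

∑-distrib-+ : ∀ (xs : List A) (F G : A → ℕ) → (∑[ x ← xs ] (F x + G x)) ≡ ∑ xs F + ∑ xs G
∑-distrib-+ []       F G = ≡.refl
∑-distrib-+ (x ∷ xs) F G = ≡.trans (cong (F x + G x +_) (∑-distrib-+ xs F G)) (interchange (F x) (G x) _ _)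
  where
  interchange : ∀ s t u v → s + t + (u + v) ≡ s + u + (t + v)
  interchange = solve-∀

*-distribˡ-∑ : ∀ (xs : List A) c (F : A → ℕ) → (∑[ x ← xs ] c * F x) ≡ c * ∑ xs F
*-distribˡ-∑ []       c F = ≡.sym (*-zeroʳ c)
*-distribˡ-∑ (x ∷ xs) c F = ≡.trans (cong (c * F x +_) (*-distribˡ-∑ xs c F)) (≡.sym (*-distribˡ-+ c (F x) _))

∑-const : ∀ (xs : List A) c → (∑[ _ ← xs ] c) ≡ length xs * c
∑-const []       c = ≡.refl
∑-const (_ ∷ xs) c = cong (c +_) (∑-const xs c)

∑-swap : ∀ (xs : List A) (ys : List B) (F : A → B → ℕ) →
  (∑[ x ← xs ] ∑[ y ← ys ] F x y) ≡ (∑[ y ← ys ] ∑[ x ← xs ] F x y)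
∑-swap []       ys F = ≡.sym (≡.trans (∑-const ys 0) (*-zeroʳ (length ys)))
∑-swap (x ∷ xs) ys F = ≡.trans (cong (∑ ys (F x) +_) (∑-swap xs ys F)) (≡.sym (∑-distrib-+ ys (F x) _))

∑-++ : ∀ (xs ys : List A) (F : A → ℕ) → ∑ (xs ++ ys) F ≡ ∑ xs F + ∑ ys F
∑-++ xs ys F = ≡.trans (cong sum (map-++ F xs ys)) (sum-++ (List.map F xs) (List.map F ys))

∑-cartesianProductWith : ∀ {C : Set p} (f : A → B → C) xs ys (F : C → ℕ) →
  ∑ (cartesianProductWith f xs ys) F ≡ (∑[ x ← xs ] ∑[ y ← ys ] F (f x y))
∑-cartesianProductWith f []       ys F = ≡.refl
∑-cartesianProductWith f (x ∷ xs) ys F = ≡.trans (∑-++ (List.map (f x) ys) _ F)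
  (cong₂ _+_ (cong sum (≡.sym (map-∘ ys))) (∑-cartesianProductWith f xs ys F))

∑-∈ : ∀ {xs : List A} {x} (F : A → ℕ) → x ∈ xs → F x ≤ ∑ xs F
∑-∈ F (here ≡.refl)  = m≤m+n _ _
∑-∈ F (there x∈xs) = ≤-trans (∑-∈ F x∈xs) (m≤n+m _ _)

-- A largest term is at least the mean; the inequality is multiplied out to avoid division.
∑-pigeonhole : ∀ (xs : List A) (F : A → ℕ) → 0 < length xs →
  ∃ λ x → x ∈ xs × ∑ xs F ≤ length xs * F x
∑-pigeonhole (x ∷ [])      F _ = x , here ≡.refl , ≤-refl
∑-pigeonhole (x ∷ y ∷ xs) F _ with ∑-pigeonhole (y ∷ xs) F (s≤s z≤n)
... | z , z∈ , ∑≤ with ≤-total (F x) (F z)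
...   | inj₁ Fx≤Fz = z , there z∈ , +-mono-≤ Fx≤Fz ∑≤
...   | inj₂ Fz≤Fx = x , here ≡.refl , +-monoʳ-≤ (F x) (≤-trans ∑≤ (*-monoʳ-≤ (suc (length xs)) Fz≤Fx))

2mn≤m²+n² : ∀ m n → 2 * (m * n) ≤ m * m + n * n
2mn≤m²+n² m n with ≤-total m n
... | inj₁ m≤n with d , ≡.refl ← m≤n⇒∃[o]m+o≡n m≤n = ≤-trans (m≤m+n _ (d * d)) (≤-reflexive (lemma m d))
  where
  lemma : ∀ m d → 2 * (m * (m + d)) + d * d ≡ m * m + (m + d) * (m + d)
  lemma = solve-∀
... | inj₂ n≤m with d , ≡.refl ← m≤n⇒∃[o]m+o≡n n≤m = ≤-trans (m≤m+n _ (d * d)) (≤-reflexive (lemma n d))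
  where
  lemma : ∀ n d → 2 * ((n + d) * n) + d * d ≡ (n + d) * (n + d) + n * n
  lemma = solve-∀

cauchy-schwarz : ∀ (xs : List A) (F : A → ℕ) →
  ∑ xs F * ∑ xs F ≤ length xs * (∑[ x ← xs ] F x * F x)
cauchy-schwarz []       F = z≤n
cauchy-schwarz (x ∷ xs) F = begin
  (u + S) * (u + S)                   ≡⟨ expand u S ⟩
  u * u + 2 * (u * S) + S * S         ≤⟨ +-mono-≤ (+-monoʳ-≤ (u * u) cross) (cauchy-schwarz xs F) ⟩
  u * u + (l * (u * u) + Q) + l * Q   ≡⟨ collect u l Q ⟩
  (1 + l) * (u * u + Q)               ∎
  where
  open ≤-Reasoning
  u = F x
  S = ∑ xs F
  l = length xs
  Q = ∑[ y ← xs ] F y * F y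
  expand : ∀ u S → (u + S) * (u + S) ≡ u * u + 2 * (u * S) + S * S
  expand = solve-∀
  collect : ∀ u l Q → u * u + (l * (u * u) + Q) + l * Q ≡ (1 + l) * (u * u + Q)
  collect = solve-∀
  -- The cross term is spread over the tail, and `2mn≤m²+n²` is applied to each summand.
  cross : 2 * (u * S) ≤ l * (u * u) + Q
  cross = begin
    2 * (u * S)                        ≡⟨ cong (2 *_) (*-distribˡ-∑ xs u F) ⟨
    2 * (∑[ y ← xs ] u * F y)          ≡⟨ *-distribˡ-∑ xs 2 _ ⟨
    (∑[ y ← xs ] 2 * (u * F y))        ≤⟨ ∑-mono xs (λ {y} _ → 2mn≤m²+n² u (F y)) ⟩
    (∑[ y ← xs ] (u * u + F y * F y))  ≡⟨ ∑-distrib-+ xs _ _ ⟩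
    (∑[ _ ← xs ] u * u) + Q            ≡⟨ cong (_+ Q) (∑-const xs (u * u)) ⟩
    l * (u * u) + Q                    ∎

-- Indicators and collisions of colours.

𝟙 : {P : Set p} → Dec P → ℕ
𝟙 P? = if does P? then 1 else 0

𝟙-mono : {P : Set p} {Q : Set q} (P? : Dec P) (Q? : Dec Q) → (P → Q) → 𝟙 P? ≤ 𝟙 Q?
𝟙-mono (no _)   _        P→Q = z≤n
𝟙-mono (yes _)  (yes _)  P→Q = ≤-refl
𝟙-mono (yes p)  (no ¬q)  P→Q = contradiction (P→Q p) ¬q

𝟙-cong : {P : Set p} {Q : Set q} (P? : Dec P) (Q? : Dec Q) → (P → Q) → (Q → P) → 𝟙 P? ≡ 𝟙 Q?
𝟙-cong P? Q? P→Q Q→P = ≤-antisym (𝟙-mono P? Q? P→Q) (𝟙-mono Q? P? Q→P)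

𝟙-true : {P : Set p} (P? : Dec P) → P → 1 ≤ 𝟙 P?
𝟙-true P? p = 𝟙-mono (yes p) P? id

𝟙-≤ : {P : Set p} (P? : Dec P) {n : ℕ} → (P → 1 ≤ n) → 𝟙 P? ≤ n
𝟙-≤ (no _)  _   = z≤n
𝟙-≤ (yes p) 1≤n = 1≤n p

𝟙-×-dec : {P : Set p} {Q : Set q} (P? : Dec P) (Q? : Dec Q) → 𝟙 (P? ×-dec Q?) ≡ 𝟙 P? * 𝟙 Q?
𝟙-×-dec (no _)  _       = ≡.refl
𝟙-×-dec (yes _) (no _)  = ≡.refl
𝟙-×-dec (yes _) (yes _) = ≡.refl

length-filter-𝟙 : {P : Pred A p} (P? : Decidable P) (xs : List A) →
  length (filter P? xs) ≡ ∑[ x ← xs ] 𝟙 (P? x)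
length-filter-𝟙 P? []       = ≡.refl
length-filter-𝟙 P? (x ∷ xs) with does (P? x)
... | true  = cong suc (length-filter-𝟙 P? xs)
... | false = length-filter-𝟙 P? xs

∑-allFin-suc : ∀ {r} (F : Fin (suc r) → ℕ) → ∑ (allFin (suc r)) F ≡ F zero + ∑ (allFin r) (F ∘ suc)
∑-allFin-suc {r} F = cong (λ xs → F zero + sum xs) (≡.trans (map-tabulate suc F) (≡.sym (map-tabulate id (F ∘ suc))))

∑-δ : ∀ {r} (i : Fin r) (F : Fin r → ℕ) → (∑[ k ← allFin r ] 𝟙 (i Fin.≟ k) * F k) ≡ F i
∑-δ {suc r} zero F = begin
  (∑[ k ← allFin (suc r) ] 𝟙 (zero Fin.≟ k) * F k)  ≡⟨ ∑-allFin-suc (λ k → 𝟙 (zero Fin.≟ k) * F k) ⟩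
  1 * F zero + (∑[ _ ← allFin r ] 0)
    ≡⟨ cong₂ _+_ (*-identityˡ (F zero)) (≡.trans (∑-const (allFin r) 0) (*-zeroʳ (length (allFin r)))) ⟩
  F zero + 0                                         ≡⟨ +-identityʳ _ ⟩
  F zero                                             ∎
  where open ≡.≡-Reasoning
∑-δ {suc r} (suc i) F = begin
  (∑[ k ← allFin (suc r) ] 𝟙 (suc i Fin.≟ k) * F k)      ≡⟨ ∑-allFin-suc (λ k → 𝟙 (suc i Fin.≟ k) * F k) ⟩
  (∑[ k ← allFin r ] 𝟙 (suc i Fin.≟ suc k) * F (suc k))
    ≡⟨ ∑-cong (allFin r) (λ k → cong (_* F (suc k))
         (𝟙-cong (suc i Fin.≟ suc k) (i Fin.≟ k) (λ { ≡.refl → ≡.refl }) (cong suc))) ⟩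
  (∑[ k ← allFin r ] 𝟙 (i Fin.≟ k) * F (suc k))          ≡⟨ ∑-δ i (F ∘ suc) ⟩
  F (suc i)                                              ∎
  where open ≡.≡-Reasoning

-- Exactly one `k` equals `i`. Collisions are thereby sorted by colour for the later pigeonholes.
𝟙-≟-split : ∀ {r} (i j : Fin r) → 𝟙 (i Fin.≟ j) ≡ ∑[ k ← allFin r ] 𝟙 ((i Fin.≟ k) ×-dec (j Fin.≟ k))
𝟙-≟-split {r} i j = begin
  𝟙 (i Fin.≟ j)                                            ≡⟨ 𝟙-cong (i Fin.≟ j) (j Fin.≟ i) ≡.sym ≡.sym ⟩
  𝟙 (j Fin.≟ i)                                            ≡⟨ ∑-δ i (λ k → 𝟙 (j Fin.≟ k)) ⟨
  (∑[ k ← allFin r ] 𝟙 (i Fin.≟ k) * 𝟙 (j Fin.≟ k))        ≡⟨ ∑-cong (allFin r) (λ k → 𝟙-×-dec (i Fin.≟ k) (j Fin.≟ k)) ⟨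
  (∑[ k ← allFin r ] 𝟙 ((i Fin.≟ k) ×-dec (j Fin.≟ k)))    ∎
  where open ≡.≡-Reasoning

length-allFin : ∀ r → length (allFin r) ≡ r
length-allFin r = length-tabulate id

-- Cauchy-Schwarz for the sizes `N k` of the colour classes: they add up to `length xs`, and their
-- squares count the ordered pairs of equal colour.
collisions : ∀ {r} (xs : List A) (f : A → Fin r) →
  length xs * length xs ≤ r * (∑[ x ← xs ] ∑[ y ← xs ] 𝟙 (f x Fin.≟ f y))
collisions {r = r} xs f = begin
  length xs * length xs                              ≡⟨ cong (λ l → l * l) total ⟨
  ∑ (allFin r) N * ∑ (allFin r) N                    ≤⟨ cauchy-schwarz (allFin r) N ⟩
  length (allFin r) * (∑[ k ← allFin r ] N k * N k)  ≡⟨ cong₂ _*_ (length-allFin r) squares ⟩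
  r * (∑[ x ← xs ] ∑[ y ← xs ] 𝟙 (f x Fin.≟ f y))    ∎
  where
  N : Fin r → ℕ
  N k = ∑[ x ← xs ] 𝟙 (f x Fin.≟ k)
  total : ∑ (allFin r) N ≡ length xs
  total = let open ≡.≡-Reasoning in begin
    ∑ (allFin r) N                                    ≡⟨ ∑-swap (allFin r) xs _ ⟩
    (∑[ x ← xs ] ∑[ k ← allFin r ] 𝟙 (f x Fin.≟ k))
      ≡⟨ ∑-cong xs (λ x → ≡.trans (∑-cong (allFin r) (λ k → ≡.sym (*-identityʳ _))) (∑-δ (f x) (λ _ → 1))) ⟩
    (∑[ _ ← xs ] 1)                                   ≡⟨ ∑-const xs 1 ⟩
    length xs * 1                                     ≡⟨ *-identityʳ _ ⟩
    length xs                                         ∎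
  squares : (∑[ k ← allFin r ] N k * N k) ≡ (∑[ x ← xs ] ∑[ y ← xs ] 𝟙 (f x Fin.≟ f y))
  squares = let open ≡.≡-Reasoning in begin
    (∑[ k ← allFin r ] N k * N k)
      ≡⟨ ∑-cong (allFin r) (λ k → *-distribˡ-∑ xs (N k) _) ⟨
    (∑[ k ← allFin r ] ∑[ y ← xs ] N k * 𝟙 (f y Fin.≟ k))
      ≡⟨ ∑-swap (allFin r) xs _ ⟩
    (∑[ y ← xs ] ∑[ k ← allFin r ] N k * 𝟙 (f y Fin.≟ k))
      ≡⟨ ∑-cong xs (λ y → ≡.trans (∑-cong (allFin r) (λ k → *-comm (N k) _)) (∑-δ (f y) N)) ⟩
    (∑[ y ← xs ] N (f y))
      ≡⟨ ∑-swap xs xs _ ⟩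
    (∑[ x ← xs ] ∑[ y ← xs ] 𝟙 (f x Fin.≟ f y)) ∎
  open ≤-Reasoning

-- Distinct representatives in lists.

lookup-injective : ∀ {ℓ} {R : Rel A ℓ} → Binary.Symmetric R → ∀ {xs} → AllPairs (λ x y → ¬ R x y) xs →
  ∀ i j → R (lookup xs i) (lookup xs j) → i ≡ j
lookup-injective R-sym (_  ∷ _)   zero    zero    _ = ≡.refl
lookup-injective R-sym (¬R ∷ _)   zero    (suc j) r = contradiction r (All.lookup ¬R (∈-lookup j))
lookup-injective R-sym (¬R ∷ _)   (suc i) zero    r = contradiction (R-sym r) (All.lookup ¬R (∈-lookup i))
lookup-injective R-sym (_  ∷ ¬Rs) (suc i) (suc j) r = cong suc (lookup-injective R-sym ¬Rs i j r)

-- Greedy choice: an entry is kept unless it is related to one already kept. Later this picks one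
-- point from each coset of the periods.
representatives : ∀ {ℓ} {R : Rel A ℓ} → Reflexive R → Binary.Decidable R → ∀ xs →
  ∃ λ ys → (∀ {y} → y ∈ ys → y ∈ xs) × AllPairs (λ x y → ¬ R x y) ys ×
  (∀ {x} → x ∈ xs → ∃ λ y → y ∈ ys × R x y)
representatives refl′ R? [] = [] , (λ ()) , [] , λ ()
representatives {R = R} refl′ R? (x ∷ xs) with representatives refl′ R? xs
... | ys , ys⊆xs , ¬R , cover with any? (R? x) ys
...   | yes Rx = ys , there ∘ ys⊆xs , ¬R , λ { (here ≡.refl) → find Rx ; (there z∈) → cover z∈ }
...   | no ¬Rx = x ∷ ys , (λ { (here e) → here e ; (there y∈) → there (ys⊆xs y∈) })
               , ¬Any⇒All¬ ys ¬Rx ∷ ¬R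
               , λ { (here ≡.refl) → x , here ≡.refl , refl′ ; (there z∈) → map₂ (map₁ there) (cover z∈) }

-- Sums over initial segments of ℕ.

∑-upTo-suc : ∀ n (F : ℕ → ℕ) → ∑ (upTo (suc n)) F ≡ F 0 + ∑ (upTo n) (F ∘ suc)
∑-upTo-suc n F = cong (λ xs → F 0 + sum xs) (≡.trans (map-applyUpTo suc F n) (≡.sym (map-upTo (F ∘ suc) n)))

∑-upTo-∷ʳ : ∀ n (F : ℕ → ℕ) → ∑ (upTo (suc n)) F ≡ ∑ (upTo n) F + F n
∑-upTo-∷ʳ n F = begin
  ∑ (upTo (suc n)) F      ≡⟨ cong (λ xs → ∑ xs F) (upTo-∷ʳ n) ⟨
  ∑ (upTo n ∷ʳ n) F       ≡⟨ ∑-++ (upTo n) (n ∷ []) F ⟩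
  ∑ (upTo n) F + (F n + 0)  ≡⟨ cong (∑ (upTo n) F +_) (+-identityʳ (F n)) ⟩
  ∑ (upTo n) F + F n      ∎
  where open ≡.≡-Reasoning

∑-upTo-mono : ∀ {m n} (F : ℕ → ℕ) → m ≤ n → ∑ (upTo m) F ≤ ∑ (upTo n) F
∑-upTo-mono F z≤n = z≤n
∑-upTo-mono F (s≤s {m} {n} m≤n) = begin
  ∑ (upTo (suc m)) F            ≡⟨ ∑-upTo-suc m F ⟩
  F 0 + ∑ (upTo m) (F ∘ suc)    ≤⟨ +-monoʳ-≤ (F 0) (∑-upTo-mono (F ∘ suc) m≤n) ⟩
  F 0 + ∑ (upTo n) (F ∘ suc)    ≡⟨ ∑-upTo-suc n F ⟨
  ∑ (upTo (suc n)) F            ∎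
  where open ≤-Reasoning

∑-upTo-shift : ∀ x n (F : ℕ → ℕ) → (∑[ y ← upTo n ] F (x + y)) ≤ ∑ (upTo (x + n)) F
∑-upTo-shift zero    n F = ≤-refl
∑-upTo-shift (suc x) n F = begin
  (∑[ y ← upTo n ] F (suc x + y))      ≤⟨ ∑-upTo-shift x n (F ∘ suc) ⟩
  ∑ (upTo (x + n)) (F ∘ suc)           ≤⟨ m≤n+m _ (F 0) ⟩
  F 0 + ∑ (upTo (x + n)) (F ∘ suc)     ≡⟨ ∑-upTo-suc (x + n) F ⟨
  ∑ (upTo (suc x + n)) F               ∎
  where open ≤-Reasoning

-- Mirror pairs in a coloured interval.

module _ {r : ℕ} (f : ℕ → Fin r) where

  Mirrored : ℕ → Fin r → ℕ → Set
  Mirrored s k x = x ≤ s × f x ≡ k × f (s ∸ x) ≡ k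

  mirrored? : ∀ s k → Decidable (Mirrored s k)
  mirrored? s k x = (x ≤? s) ×-dec (f x Fin.≟ k) ×-dec (f (s ∸ x) Fin.≟ k)

  -- Of the K² ordered pairs of points, at least K²/r have equal colours. Each of these has one of
  -- at most 2K sums and one of r colours, so some sum and colour occur together at least K/(2r²) =
  -- n times; hence the factor 2 in `K`.
  mirrored-interval : 0 < r → ∀ n →
    ∃₂ λ s k → n ≤ length (filter (mirrored? s k) (upTo (2 * (r * r * n))))
  -- Here the interval is empty and offers no sum to choose from, so a default centre and colour are
  -- supplied.
  mirrored-interval 0<r zero = 0 , Fin.fromℕ< 0<r , z≤n
  mirrored-interval 0<r n@(suc _) = s , k , subst (n ≤_) (≡.sym (length-filter-𝟙 (mirrored? s k) (upTo K))) n≤C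
    where
    K = 2 * (r * r * n)
    C : ℕ → Fin r → ℕ
    C s k = ∑[ x ← upTo K ] 𝟙 (mirrored? s k x)
    perPoint : ∀ {x} → x ∈ upTo K →
      (∑[ y ← upTo K ] 𝟙 (f x Fin.≟ f y)) ≤ (∑[ s ← upTo (K + K) ] ∑[ k ← allFin r ] 𝟙 (mirrored? s k x))
    perPoint {x} x∈ = begin
      (∑[ y ← upTo K ] 𝟙 (f x Fin.≟ f y))
        ≡⟨ ∑-cong (upTo K) (λ y → 𝟙-≟-split (f x) (f y)) ⟩
      (∑[ y ← upTo K ] ∑[ k ← allFin r ] 𝟙 ((f x Fin.≟ k) ×-dec (f y Fin.≟ k)))
        ≤⟨ ∑-mono (upTo K) (λ {y} _ → ∑-mono (allFin r) (λ {k} _ →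
             𝟙-mono ((f x Fin.≟ k) ×-dec (f y Fin.≟ k)) (mirrored? (x + y) k x)
               λ { (fx≡k , fy≡k) → m≤m+n x y , fx≡k , ≡.trans (cong f (m+n∸m≡n x y)) fy≡k })) ⟩
      (∑[ y ← upTo K ] ∑[ k ← allFin r ] 𝟙 (mirrored? (x + y) k x))
        ≤⟨ ∑-upTo-shift x K (λ s → ∑[ k ← allFin r ] 𝟙 (mirrored? s k x)) ⟩
      (∑[ s ← upTo (x + K) ] ∑[ k ← allFin r ] 𝟙 (mirrored? s k x))
        ≤⟨ ∑-upTo-mono (λ s → ∑[ k ← allFin r ] 𝟙 (mirrored? s k x)) (+-monoˡ-≤ K (<⇒≤ (∈-upTo⁻ x∈))) ⟩
      (∑[ s ← upTo (K + K) ] ∑[ k ← allFin r ] 𝟙 (mirrored? s k x)) ∎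
      where open ≤-Reasoning
    instance
      r≢0 : NonZero r
      r≢0 = >-nonZero 0<r
      rr≢0 : NonZero (r * r)
      rr≢0 = m*n≢0 r r
      rrn≢0 : NonZero (r * r * n)
      rrn≢0 = m*n≢0 (r * r) n
      K≢0 : NonZero K
      K≢0 = m*n≢0 2 (r * r * n)
      2rr≢0 : NonZero (2 * (r * r))
      2rr≢0 = m*n≢0 2 (r * r)
    center = ∑-pigeonhole (upTo (K + K)) (λ s → ∑[ k ← allFin r ] C s k)
               (subst (0 <_) (≡.sym (length-upTo (K + K))) (≤-trans (>-nonZero⁻¹ K) (m≤m+n K K)))
    s = proj₁ center
    colour = ∑-pigeonhole (allFin r) (C s) (subst (0 <_) (≡.sym (length-allFin r)) 0<r)
    k = proj₁ colour
    K²≤ : K * K ≤ K * (2 * (r * r) * C s k)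
    K²≤ = begin
      K * K                                        ≡⟨ cong (λ l → l * l) (length-upTo K) ⟨
      length (upTo K) * length (upTo K)            ≤⟨ collisions (upTo K) f ⟩
      r * (∑[ x ← upTo K ] ∑[ y ← upTo K ] 𝟙 (f x Fin.≟ f y))
        ≤⟨ *-monoʳ-≤ r (∑-mono (upTo K) perPoint) ⟩
      r * (∑[ x ← upTo K ] ∑[ s ← upTo (K + K) ] ∑[ k ← allFin r ] 𝟙 (mirrored? s k x))
        ≡⟨ cong (r *_) (≡.trans (∑-swap (upTo K) (upTo (K + K)) _)
             (∑-cong (upTo (K + K)) (λ s → ∑-swap (upTo K) (allFin r) _))) ⟩
      r * (∑[ s ← upTo (K + K) ] ∑[ k ← allFin r ] C s k)
        ≤⟨ *-monoʳ-≤ r (proj₂ (proj₂ center)) ⟩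
      r * (length (upTo (K + K)) * ∑ (allFin r) (C s))
        ≤⟨ *-monoʳ-≤ r (*-mono-≤ (≤-reflexive (length-upTo (K + K))) (proj₂ (proj₂ colour))) ⟩
      r * ((K + K) * (length (allFin r) * C s k))
        ≡⟨ cong (λ l → r * ((K + K) * (l * C s k))) (length-allFin r) ⟩
      r * ((K + K) * (r * C s k))
        ≡⟨ rearrange r K (C s k) ⟩
      K * (2 * (r * r) * C s k) ∎
      where
      open ≤-Reasoning
      rearrange : ∀ r K c → r * ((K + K) * (r * c)) ≡ K * (2 * (r * r) * c)
      rearrange = solve-∀
    n≤C : n ≤ C s k
    n≤C = *-cancelˡ-≤ (2 * (r * r)) (subst (_≤ 2 * (r * r) * C s k) (≡.sym (*-assoc 2 (r * r) n)) (*-cancelˡ-≤ K K²≤))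

-- Coefficient vectors over ℕ.

infixl 6 _⊕_
infixr 7 _⊙_

_⊕_ : Vec ℕ m → Vec ℕ m → Vec ℕ m
_⊕_ = zipWith _+_

_⊙_ : ℕ → Vec ℕ m → Vec ℕ m
n ⊙ c = map (n *_) c

𝟎 : Vec ℕ m
𝟎 = replicate _ 0

⊕-comm : (x y : Vec ℕ m) → x ⊕ y ≡ y ⊕ x
⊕-comm = zipWith-comm +-comm

⊕-assoc : (x y z : Vec ℕ m) → (x ⊕ y) ⊕ z ≡ x ⊕ (y ⊕ z)
⊕-assoc = zipWith-assoc +-assoc

⊕-identityˡ : (x : Vec ℕ m) → 𝟎 ⊕ x ≡ x
⊕-identityˡ = zipWith-identityˡ +-identityˡ

⊕-swapʳ : (x y z : Vec ℕ m) → (x ⊕ y) ⊕ z ≡ (x ⊕ z) ⊕ y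
⊕-swapʳ x y z = ≡.trans (⊕-assoc x y z) (≡.trans (cong (x ⊕_) (⊕-comm y z)) (≡.sym (⊕-assoc x z y)))

-- For n = `q` the right side is a translate of `x` by a period: adding `y` and then `q ⊙ y`
-- cancels.
⊕-suc-⊙ : ∀ n (x y : Vec ℕ m) → (x ⊕ y) ⊕ n ⊙ y ≡ x ⊕ suc n ⊙ y
⊕-suc-⊙ n []      []      = ≡.refl
⊕-suc-⊙ n (x ∷ xs) (y ∷ ys) = cong₂ _∷_ (+-assoc x y (n * y)) (⊕-suc-⊙ n xs ys)

⊕-double : (x u v : Vec ℕ m) → x ⊕ (v ⊕ v) ⊕ u ⊕ u ≡ x ⊕ ((u ⊕ v) ⊕ (u ⊕ v))
⊕-double []       []       []       = ≡.refl
⊕-double (x ∷ xs) (u ∷ us) (v ∷ vs) = cong₂ _∷_ (lemma x u v) (⊕-double xs us vs)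
  where
  lemma : ∀ x u v → x + (v + v) + u + u ≡ x + ((u + v) + (u + v))
  lemma = solve-∀

0<length : ∀ {a} {A : Set a} {x : A} {xs} → x ∈ xs → 0 < length xs
0<length (here _)  = s≤s z≤n
0<length (there _) = s≤s z≤n

-- The group (ℤ/M)^m, represented by a box of residues.

module _ (q : ℕ) where
  -- As a successor the modulus is nonzero by construction, and `q` is -1 modulo `M`, so natural
  -- coefficients suffice for negation.
  private M = suc q

  box : ∀ m → List (Vec ℕ m)
  box zero    = [] ∷ []
  box (suc m) = cartesianProductWith _∷_ (upTo M) (box m)

  residue : Vec ℕ m → Vec ℕ m
  residue = map (_% M)

  residue∈box : (c : Vec ℕ m) → residue c ∈ box m
  residue∈box []       = here ≡.refl
  residue∈box (c ∷ cs) = ∈-cartesianProductWith⁺ _∷_ (∈-upTo⁺ (m%n<n c M)) (residue∈box cs)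

  ∈-box⁻ : {c : Vec ℕ m} → c ∈ box m → Vec.All (_≤ M) c
  ∈-box⁻ {m = zero}  {[]} _ = Vec.[]
  ∈-box⁻ {m = suc m} c∈ with ∈-cartesianProductWith⁻ _∷_ (upTo M) (box m) c∈
  ... | c , cs , c<M , cs∈ , ≡.refl = <⇒≤ (∈-upTo⁻ c<M) Vec.∷ ∈-box⁻ cs∈

  residue-⊕ : (c d : Vec ℕ m) → residue (c ⊕ M ⊙ d) ≡ residue c
  residue-⊕ []       []       = ≡.refl
  residue-⊕ (c ∷ cs) (d ∷ ds) = cong₂ _∷_
    (≡.trans (cong (λ z → (c + z) % M) (*-comm M d)) ([m+kn]%n≡m%n c d M)) (residue-⊕ cs ds)

  residue-quotient : (c : Vec ℕ m) → c ≡ residue c ⊕ M ⊙ map (_/ M) c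
  residue-quotient []       = ≡.refl
  residue-quotient (c ∷ cs) = cong₂ _∷_
    (≡.trans (m≡m%n+[m/n]*n c M) (cong (c % M +_) (*-comm (c / M) M))) (residue-quotient cs)

  Periodic : ∀ {a} {A : Set a} → (Vec ℕ m → A) → Set a
  Periodic F = ∀ c d → F (c ⊕ M ⊙ d) ≡ F c

  ∑-upTo-translate : ∀ v (F : ℕ → ℕ) → (∀ c → F (c + M) ≡ F c) →
    (∑[ c ← upTo M ] F (c + v)) ≡ ∑ (upTo M) F
  ∑-upTo-translate zero    F per = ∑-cong (upTo M) (λ c → cong F (+-identityʳ c))
  ∑-upTo-translate (suc v) F per = begin
    (∑[ c ← upTo M ] F (c + suc v))  ≡⟨ ∑-cong (upTo M) (λ c → cong F (+-suc c v)) ⟩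
    ∑ (upTo M) (H ∘ suc)             ≡⟨ +-cancelˡ-≡ (H 0) _ _ cyclic ⟩
    ∑ (upTo M) H                     ≡⟨ ∑-upTo-translate v F per ⟩
    ∑ (upTo M) F                     ∎
    where
    open ≡.≡-Reasoning
    H : ℕ → ℕ
    H c = F (c + v)
    -- Translation by one drops the term at 0 and adds the one at `M`; periodicity makes them equal.
    cyclic : H 0 + ∑ (upTo M) (H ∘ suc) ≡ H 0 + ∑ (upTo M) H
    cyclic = begin
      H 0 + ∑ (upTo M) (H ∘ suc)  ≡⟨ ∑-upTo-suc M H ⟨
      ∑ (upTo (suc M)) H          ≡⟨ ∑-upTo-∷ʳ M H ⟩
      ∑ (upTo M) H + H M          ≡⟨ +-comm _ (H M) ⟩
      H M + ∑ (upTo M) H          ≡⟨ cong (_+ ∑ (upTo M) H) (≡.trans (cong F (+-comm M v)) (per v)) ⟩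
      H 0 + ∑ (upTo M) H          ∎

  -- Translation permutes (ℤ/M)^m. Treated one coordinate at a time it is a cyclic shift of an
  -- interval, so no permutation of the box has to be exhibited.
  ∑-box-translate : ∀ (v : Vec ℕ m) (F : Vec ℕ m → ℕ) → Periodic F →
    (∑[ c ← box m ] F (c ⊕ v)) ≡ ∑ (box m) F
  ∑-box-translate []       F per = ≡.refl
  ∑-box-translate {suc m} (v ∷ vs) F per = begin
    (∑[ c ← box (suc m) ] F (c ⊕ (v ∷ vs)))
      ≡⟨ ∑-cartesianProductWith _∷_ (upTo M) (box m) _ ⟩
    (∑[ c ← upTo M ] ∑[ cs ← box m ] F ((c + v) ∷ (cs ⊕ vs)))
      ≡⟨ ∑-cong (upTo M) (λ c → ∑-box-translate vs (λ cs → F ((c + v) ∷ cs)) (tailPeriodic (c + v))) ⟩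
    (∑[ c ← upTo M ] ∑[ cs ← box m ] F ((c + v) ∷ cs))
      ≡⟨ ∑-upTo-translate v (λ c → ∑[ cs ← box m ] F (c ∷ cs)) (λ c → ∑-cong (box m) (headPeriodic c)) ⟩
    (∑[ c ← upTo M ] ∑[ cs ← box m ] F (c ∷ cs))
      ≡⟨ ∑-cartesianProductWith _∷_ (upTo M) (box m) F ⟨
    ∑ (box (suc m)) F ∎
    where
    open ≡.≡-Reasoning
    tailPeriodic : ∀ c → Periodic (λ cs → F (c ∷ cs))
    tailPeriodic c cs ds = ≡.trans
      (cong (λ z → F (z ∷ (cs ⊕ M ⊙ ds))) (≡.sym (≡.trans (cong (c +_) (*-zeroʳ M)) (+-identityʳ c))))
      (per (c ∷ cs) (0 ∷ ds))
    ⊕-M⊙𝟎 : ∀ {l} (cs : Vec ℕ l) → cs ⊕ M ⊙ 𝟎 ≡ cs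
    ⊕-M⊙𝟎 []       = ≡.refl
    ⊕-M⊙𝟎 (c ∷ cs) = cong₂ _∷_ (≡.trans (cong (c +_) (*-zeroʳ M)) (+-identityʳ c)) (⊕-M⊙𝟎 cs)
    headPeriodic : ∀ c cs → F ((c + M) ∷ cs) ≡ F (c ∷ cs)
    headPeriodic c cs = ≡.trans
      (cong₂ (λ z zs → F (z ∷ zs)) (cong (c +_) (≡.sym (*-identityʳ M))) (≡.sym (⊕-M⊙𝟎 cs)))
      (per (c ∷ cs) (1 ∷ 𝟎))

  -- Periods and reflections of a colouring of (ℤ/M)^m.

  module PeriodicColouring {m r : ℕ} (κ : Vec ℕ m → Fin r) (κ-periodic : Periodic κ) where

    infix 4 _~_
    -- Congruence modulo the group of periods of `κ`. Being a record, it allows `a` and `b` to be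
    -- inferred.
    record _~_ (a b : Vec ℕ m) : Set where
      constructor mk~
      field agree : ∀ y → κ (a ⊕ y) ≡ κ (b ⊕ y)
    open _~_

    ~-refl : ∀ {a} → a ~ a
    ~-refl = mk~ λ y → ≡.refl

    ~-sym : ∀ {a b} → a ~ b → b ~ a
    ~-sym a~b = mk~ λ y → ≡.sym (agree a~b y)

    ~-trans : ∀ {a b c} → a ~ b → b ~ c → a ~ c
    ~-trans a~b b~c = mk~ λ y → ≡.trans (agree a~b y) (agree b~c y)

    ≡⇒~ : ∀ {a b} → a ≡ b → a ~ b
    ≡⇒~ ≡.refl = ~-refl

    ~-⊕ʳ : ∀ {a b} c → a ~ b → a ⊕ c ~ b ⊕ c
    ~-⊕ʳ {a} {b} c a~b = mk~ λ y →
      ≡.trans (cong κ (⊕-assoc a c y)) (≡.trans (agree a~b (c ⊕ y)) (cong κ (≡.sym (⊕-assoc b c y))))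

    ~-⊕ˡ : ∀ {a b} c → a ~ b → c ⊕ a ~ c ⊕ b
    ~-⊕ˡ {a} {b} c a~b = ~-trans (≡⇒~ (⊕-comm c a)) (~-trans (~-⊕ʳ c a~b) (≡⇒~ (⊕-comm b c)))

    ~-period : ∀ a d → a ⊕ M ⊙ d ~ a
    ~-period a d = mk~ λ y → ≡.trans (cong κ (⊕-swapʳ a (M ⊙ d) y)) (κ-periodic (a ⊕ y) d)

    ~-cancelʳ : ∀ {a b} c → a ⊕ c ~ b ⊕ c → a ~ b
    ~-cancelʳ {a} {b} c ac~bc =
      ~-trans (~-sym (shift a)) (~-trans (~-⊕ʳ (q ⊙ c) ac~bc) (shift b))
      where
      shift : ∀ x → (x ⊕ c) ⊕ q ⊙ c ~ x
      shift x = ~-trans (≡⇒~ (⊕-suc-⊙ q x c)) (~-period x c)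

    ~⇒κ : ∀ {a b} → a ~ b → κ a ≡ κ b
    ~⇒κ {a} {b} a~b = ≡.trans (cong κ (≡.sym (unit a))) (≡.trans (agree a~b 𝟎) (cong κ (unit b)))
      where
      unit : ∀ x → x ⊕ 𝟎 ≡ x
      unit = zipWith-identityʳ +-identityʳ

    -- q ≡ −1 modulo the period, so this is invariance of ~ under negation.
    ~-q⊙ : ∀ {a b} → a ~ b → q ⊙ a ~ q ⊙ b
    ~-q⊙ {a} {b} a~b =
      ~-trans (~-sym (~-period (q ⊙ a) b))
        (~-trans (≡⇒~ (rotate (q ⊙ a) b))
          (~-trans (~-⊕ʳ (q ⊙ a ⊕ q ⊙ b) (~-sym a~b))
            (~-trans (≡⇒~ (≡.trans (cong (a ⊕_) (⊕-comm (q ⊙ a) (q ⊙ b))) (≡.sym (rotate (q ⊙ b) a))))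
              (~-period (q ⊙ b) a))))
      where
      rotate : ∀ x y → x ⊕ M ⊙ y ≡ y ⊕ (x ⊕ q ⊙ y)
      rotate x y = ≡.trans (≡.sym (⊕-suc-⊙ q x y)) (≡.trans (cong (_⊕ q ⊙ y) (⊕-comm x y)) (⊕-assoc y x (q ⊙ y)))

    -- Only the residue of `y` matters, so finitely many tests settle the relation. This makes it
    -- decidable and lets it be checked inside a bounded window.
    ~-box : ∀ {a b} → (∀ {y} → y ∈ box m → κ (a ⊕ y) ≡ κ (b ⊕ y)) → a ~ b
    ~-box {a} {b} onBox = mk~ λ y → ≡.trans (reduce y a) (≡.trans (onBox (residue∈box y)) (≡.sym (reduce y b)))
      where
      reduce : ∀ y x → κ (x ⊕ y) ≡ κ (x ⊕ residue y)
      reduce y x = ≡.trans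
        (cong κ (≡.trans (cong (x ⊕_) (residue-quotient y)) (≡.sym (⊕-assoc x (residue y) _))))
        (κ-periodic (x ⊕ residue y) (map (_/ M) y))

    _~?_ : ∀ a b → Dec (a ~ b)
    a ~? b = map′ (λ onBox → ~-box (All.lookup onBox)) (λ a~b → All.tabulate (λ {y} _ → agree a~b y))
                  (All.all? (λ y → κ (a ⊕ y) Fin.≟ κ (b ⊕ y)) (box m))

    -- At `𝟎` this is the order of the group of periods in (ℤ/M)^m.
    classSize : Vec ℕ m → ℕ
    classSize x = ∑[ a ← box m ] 𝟙 (a ~? x)

    classSize-const : ∀ x → classSize x ≡ classSize 𝟎
    classSize-const x = begin
      (∑[ a ← box m ] 𝟙 (a ~? x))
        ≡⟨ ∑-box-translate x (λ a → 𝟙 (a ~? x)) (λ a d →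
             𝟙-cong ((a ⊕ M ⊙ d) ~? x) (a ~? x) (~-trans (~-sym (~-period a d))) (~-trans (~-period a d))) ⟨
      (∑[ a ← box m ] 𝟙 ((a ⊕ x) ~? x))
        ≡⟨ ∑-cong (box m) (λ a → 𝟙-cong ((a ⊕ x) ~? x) (a ~? 𝟎)
             (λ ax~x → ~-cancelʳ x (~-trans ax~x (≡⇒~ (≡.sym (⊕-identityˡ x)))))
             (λ a~𝟎 → ~-trans (~-⊕ʳ x a~𝟎) (≡⇒~ (⊕-identityˡ x)))) ⟩
      (∑[ a ← box m ] 𝟙 (a ~? 𝟎)) ∎
      where open ≡.≡-Reasoning

    0<classSize : 0 < classSize 𝟎
    0<classSize = ≤-trans (𝟙-true (residue 𝟎 ~? 𝟎) residue~)
                    (∑-∈ (λ a → 𝟙 (a ~? 𝟎)) (residue∈box 𝟎))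
      where
      residue~ : residue 𝟎 ~ 𝟎
      residue~ = ~-sym (~-trans (≡⇒~ (residue-quotient 𝟎)) (~-period (residue 𝟎) _))

    -- As `q ⊙ u` is -u modulo `M`, the two points are g - u and g + u.
    Reflected : Vec ℕ m → Fin r → Vec ℕ m → Set
    Reflected g k u = κ (g ⊕ q ⊙ u) ≡ k × κ (g ⊕ u) ≡ k

    reflected? : ∀ g k → Decidable (Reflected g k)
    reflected? g k u = (κ (g ⊕ q ⊙ u) Fin.≟ k) ×-dec (κ (g ⊕ u) Fin.≟ k)

    Reflected-resp-~ : ∀ {g k a b} → a ~ b → Reflected g k a → Reflected g k b
    Reflected-resp-~ {g} a~b (κ₁ , κ₂) =
      ≡.trans (≡.sym (~⇒κ (~-⊕ˡ g (~-q⊙ a~b)))) κ₁ , ≡.trans (≡.sym (~⇒κ (~-⊕ˡ g a~b))) κ₂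

    private
      h = length (box m)

      pairs : Vec ℕ m → ℕ
      pairs g = ∑[ u ← box m ] 𝟙 (κ (g ⊕ q ⊙ u) Fin.≟ κ (g ⊕ u))

      doubled : Vec ℕ m → Vec ℕ m → Fin r
      doubled g w = κ (g ⊕ (w ⊕ w))

      doubled-periodic : ∀ g → Periodic (doubled g)
      doubled-periodic g c d = ≡.trans (cong κ (lemma g c d)) (κ-periodic (g ⊕ (c ⊕ c)) (d ⊕ d))
        where
        lemma : ∀ {l} (g c d : Vec ℕ l) → g ⊕ ((c ⊕ M ⊙ d) ⊕ (c ⊕ M ⊙ d)) ≡ (g ⊕ (c ⊕ c)) ⊕ M ⊙ (d ⊕ d)
        lemma []       []       []       = ≡.refl
        lemma (g ∷ gs) (c ∷ cs) (d ∷ ds) = cong₂ _∷_ (scalar g c d M) (lemma gs cs ds)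
          where
          scalar : ∀ g c d M → g + ((c + M * d) + (c + M * d)) ≡ g + (c + c) + M * (d + d)
          scalar = solve-∀

      -- Replacing g by g + u turns the pair g - u, g + u into g, g + 2u; a further shift by 2v
      -- gives g + 2v, g + 2(u + v). Doubling enters because the two points of a pair differ by 2u.
      recentre : ∀ u v → (∑[ g ← box m ] 𝟙 (κ (g ⊕ q ⊙ u) Fin.≟ κ (g ⊕ u)))
                       ≡ (∑[ g ← box m ] 𝟙 (doubled g v Fin.≟ doubled g (u ⊕ v)))
      recentre u v = begin
        (∑[ g ← box m ] 𝟙 (κ (g ⊕ q ⊙ u) Fin.≟ κ (g ⊕ u)))
          ≡⟨ ∑-box-translate u (λ g → 𝟙 (κ (g ⊕ q ⊙ u) Fin.≟ κ (g ⊕ u)))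
               (λ g d → cong₂ (λ i j → 𝟙 (i Fin.≟ j)) (agree (~-period g d) (q ⊙ u)) (agree (~-period g d) u)) ⟨
        (∑[ g ← box m ] 𝟙 (κ (g ⊕ u ⊕ q ⊙ u) Fin.≟ κ (g ⊕ u ⊕ u)))
          ≡⟨ ∑-cong (box m) (λ g → cong (λ i → 𝟙 (i Fin.≟ κ (g ⊕ u ⊕ u)))
               (≡.trans (cong κ (⊕-suc-⊙ q g u)) (κ-periodic g u))) ⟩
        (∑[ g ← box m ] 𝟙 (κ g Fin.≟ κ (g ⊕ u ⊕ u)))
          ≡⟨ ∑-box-translate (v ⊕ v) (λ g → 𝟙 (κ g Fin.≟ κ (g ⊕ u ⊕ u)))
               (λ g d → cong₂ (λ i j → 𝟙 (i Fin.≟ j)) (κ-periodic g d) (~⇒κ (~-⊕ʳ u (~-⊕ʳ u (~-period g d))))) ⟨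
        (∑[ g ← box m ] 𝟙 (doubled g v Fin.≟ κ (g ⊕ (v ⊕ v) ⊕ u ⊕ u)))
          ≡⟨ ∑-cong (box m) (λ g → cong (λ c → 𝟙 (doubled g v Fin.≟ κ c)) (⊕-double g u v)) ⟩
        (∑[ g ← box m ] 𝟙 (doubled g v Fin.≟ doubled g (u ⊕ v))) ∎
        where open ≡.≡-Reasoning

      -- `recentre` is available for every `v`. Summing over all of them and replacing u + v by u
      -- makes u and v independent, the form that `collisions` bounds.
      h*∑pairs : h * ∑ (box m) pairs ≡ ∑[ g ← box m ] ∑[ v ← box m ] ∑[ u ← box m ] 𝟙 (doubled g v Fin.≟ doubled g u)
      h*∑pairs = begin
        h * ∑ (box m) pairs
          ≡⟨ ∑-const (box m) (∑ (box m) pairs) ⟨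
        (∑[ v ← box m ] ∑ (box m) pairs)
          ≡⟨ ∑-cong (box m) (λ v → ≡.trans (∑-swap (box m) (box m) _)
               (≡.trans (∑-cong (box m) (λ u → recentre u v)) (∑-swap (box m) (box m) _))) ⟩
        (∑[ v ← box m ] ∑[ g ← box m ] ∑[ u ← box m ] 𝟙 (doubled g v Fin.≟ doubled g (u ⊕ v)))
          ≡⟨ ∑-swap (box m) (box m) _ ⟩
        (∑[ g ← box m ] ∑[ v ← box m ] ∑[ u ← box m ] 𝟙 (doubled g v Fin.≟ doubled g (u ⊕ v)))
          ≡⟨ ∑-cong (box m) (λ g → ∑-cong (box m) (λ v → ∑-box-translate v (λ u → 𝟙 (doubled g v Fin.≟ doubled g u))
               (λ c d → cong (λ j → 𝟙 (doubled g v Fin.≟ j)) (doubled-periodic g c d)))) ⟩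
        (∑[ g ← box m ] ∑[ v ← box m ] ∑[ u ← box m ] 𝟙 (doubled g v Fin.≟ doubled g u)) ∎
        where open ≡.≡-Reasoning

      0<h : 0 < h
      0<h = 0<length (residue∈box {m} 𝟎)

      instance
        h≢0 : NonZero h
        h≢0 = >-nonZero 0<h

      h²≤r*∑pairs : h * h ≤ r * ∑ (box m) pairs
      h²≤r*∑pairs = *-cancelˡ-≤ h (begin
        h * (h * h)
          ≡⟨ ∑-const (box m) (h * h) ⟨
        (∑[ _ ← box m ] h * h)
          ≤⟨ ∑-mono (box m) (λ {g} _ → collisions (box m) (doubled g)) ⟩
        (∑[ g ← box m ] r * (∑[ v ← box m ] ∑[ u ← box m ] 𝟙 (doubled g v Fin.≟ doubled g u)))
          ≡⟨ *-distribˡ-∑ (box m) r _ ⟩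
        r * (∑[ g ← box m ] ∑[ v ← box m ] ∑[ u ← box m ] 𝟙 (doubled g v Fin.≟ doubled g u))
          ≡⟨ cong (r *_) h*∑pairs ⟨
        r * (h * ∑ (box m) pairs)
          ≡⟨ lemma r h _ ⟩
        h * (r * ∑ (box m) pairs) ∎)
        where
        open ≤-Reasoning
        lemma : ∀ r h s → r * (h * s) ≡ h * (r * s)
        lemma = solve-∀

    -- On average over g, at least h/r of the u have equal colours at g - u and g + u. A centre
    -- reaching the mean is fixed first, then a colour, which costs another factor r.
    denseReflection : 0 < r → ∃₂ λ g k → g ∈ box m ×
      length (box m) ≤ r * r * (∑[ u ← box m ] 𝟙 (reflected? g k u))
    denseReflection 0<r = g , k , proj₁ (proj₂ centre) , *-cancelˡ-≤ h (begin
      h * h                                                    ≤⟨ h²≤r*∑pairs ⟩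
      r * ∑ (box m) pairs                                      ≤⟨ *-monoʳ-≤ r (proj₂ (proj₂ centre)) ⟩
      r * (h * pairs g)                                        ≡⟨ cong (λ s → r * (h * s)) split ⟩
      r * (h * ∑ (allFin r) C)                                 ≤⟨ *-monoʳ-≤ r (*-monoʳ-≤ h (proj₂ (proj₂ colour))) ⟩
      r * (h * (length (allFin r) * C k))                      ≡⟨ cong (λ l → r * (h * (l * C k))) (length-allFin r) ⟩
      r * (h * (r * C k))                                      ≡⟨ lemma r h (C k) ⟩
      h * (r * r * C k)                                        ∎)
      where
      open ≤-Reasoning
      lemma : ∀ r h c → r * (h * (r * c)) ≡ h * (r * r * c)
      lemma = solve-∀
      centre = ∑-pigeonhole (box m) pairs 0<h
      g = proj₁ centre
      C : Fin r → ℕ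
      C k = ∑[ u ← box m ] 𝟙 (reflected? g k u)
      split : pairs g ≡ ∑ (allFin r) C
      split = ≡.trans (∑-cong (box m) (λ u → 𝟙-≟-split (κ (g ⊕ q ⊙ u)) (κ (g ⊕ u)))) (∑-swap (box m) (allFin r) _)
      colour = ∑-pigeonhole (allFin r) C (subst (0 <_) (≡.sym (length-allFin r)) 0<r)
      k = proj₁ colour

    -- Each reflected point lies in the class of a representative, and every class meets the box in
    -- `classSize 𝟎` points; this bounds the number of classes from below.
    reflectedRepresentatives : ∀ g k → ∃ λ R → AllPairs (λ a b → ¬ a ~ b) R ×
      (∀ {a} → a ∈ R → a ∈ box m × Reflected g k a) ×
      (∑[ u ← box m ] 𝟙 (reflected? g k u)) ≤ length R * classSize 𝟎
    reflectedRepresentatives g k with representatives {R = _~_} ~-refl _~?_ (filter (reflected? g k) (box m))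
    ... | R , R⊆ , distinct , cover = R , distinct , ∈-filter⁻ (reflected? g k) ∘ R⊆ , (begin
      (∑[ u ← box m ] 𝟙 (reflected? g k u))
        ≤⟨ ∑-mono (box m) (λ {u} u∈ → 𝟙-≤ (reflected? g k u) (covered u∈)) ⟩
      (∑[ u ← box m ] ∑[ a ← R ] 𝟙 (u ~? a))
        ≡⟨ ∑-swap (box m) R _ ⟩
      ∑ R classSize
        ≡⟨ ∑-cong R classSize-const ⟩
      (∑[ _ ← R ] classSize 𝟎)
        ≡⟨ ∑-const R _ ⟩
      length R * classSize 𝟎 ∎)
      where
      open ≤-Reasoning
      covered : ∀ {u} → u ∈ box m → Reflected g k u → 1 ≤ (∑[ a ← R ] 𝟙 (u ~? a))
      covered {u} u∈ ref with cover (∈-filter⁺ (reflected? g k) u∈ ref)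
      ... | a , a∈ , u~a = ≤-trans (𝟙-true (u ~? a) u~a) (∑-∈ (λ a → 𝟙 (u ~? a)) a∈)

    -- Pairs (x, i) with x ~ e i are counted in two ways: each i is paired with `classSize 𝟎` points
    -- of the box, so some x reaches the mean. Averaging over points spares a list of cosets.
    largeClass : ∀ {s} (e : Fin s → Vec ℕ m) → ∃₂ λ x I → x ∈ box m × Unique I ×
      (∀ {i} → i ∈ I → e i ~ x) × s * classSize 𝟎 ≤ length (box m) * length I
    largeClass {s} e = x , I , proj₁ (proj₂ pick) , Unique.filter⁺ (λ i → x ~? e i) (Unique.allFin⁺ s)
      , (λ i∈ → ~-sym (proj₂ (∈-filter⁻ (λ i → x ~? e i) {xs = allFin s} i∈))) , (begin
      s * classSize 𝟎                                    ≡⟨ cong (_* classSize 𝟎) (length-allFin s) ⟨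
      length (allFin s) * classSize 𝟎                    ≡⟨ ∑-const (allFin s) _ ⟨
      (∑[ _ ← allFin s ] classSize 𝟎)                    ≡⟨ ∑-cong (allFin s) (λ i → classSize-const (e i)) ⟨
      (∑[ i ← allFin s ] ∑[ x ← box m ] 𝟙 (x ~? e i))    ≡⟨ ∑-swap (allFin s) (box m) _ ⟩
      ∑ (box m) hits                                     ≤⟨ proj₂ (proj₂ pick) ⟩
      h * hits x                                         ≡⟨ cong (h *_) (length-filter-𝟙 (λ i → x ~? e i) (allFin s)) ⟨
      h * length I                                       ∎)
      where
      open ≤-Reasoning
      hits : Vec ℕ m → ℕ
      hits x = ∑[ i ← allFin s ] 𝟙 (x ~? e i)
      pick = ∑-pigeonhole (box m) hits 0<h
      x = proj₁ pick
      I = filter (λ i → x ~? e i) (allFin s)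

-- Bounded vectors and local periods.

Bounded : ∀ {m} → ℕ → Vec ℕ m → Set
Bounded L = Vec.All (_≤ L)

Bounded-mono : ∀ {m L L′} {c : Vec ℕ m} → L ≤ L′ → Bounded L c → Bounded L′ c
Bounded-mono L≤L′ = Vec.map (λ c≤L → ≤-trans c≤L L≤L′)

Bounded-⊕ : ∀ {m L L′} {c d : Vec ℕ m} → Bounded L c → Bounded L′ d → Bounded (L + L′) (c ⊕ d)
Bounded-⊕ Vec.[]       Vec.[]       = Vec.[]
Bounded-⊕ (c Vec.∷ cs) (d Vec.∷ ds) = +-mono-≤ c d Vec.∷ Bounded-⊕ cs ds

Bounded-⊙ : ∀ {m L} n {c : Vec ℕ m} → Bounded L c → Bounded (n * L) (n ⊙ c)
Bounded-⊙ n Vec.[]       = Vec.[]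
Bounded-⊙ n (c Vec.∷ cs) = *-monoʳ-≤ n c Vec.∷ Bounded-⊙ n cs

Bounded-replicate : ∀ m {n} → Bounded n (replicate m n)
Bounded-replicate zero    = Vec.[]
Bounded-replicate (suc m) = ≤-refl Vec.∷ Bounded-replicate m

Bounded-∸ : ∀ {m L} {c : Vec ℕ m} d → Bounded L c → Bounded L (zipWith _∸_ c d)
Bounded-∸ []       Vec.[]       = Vec.[]
Bounded-∸ {c = c ∷ _} (d ∷ ds) (c≤ Vec.∷ cs≤) = ≤-trans (m∸n≤m c d) c≤ Vec.∷ Bounded-∸ ds cs≤

-- As n ≥ 1, every coordinate of `n ⊙ replicate m V` is at least V, so the subtraction does not
-- truncate.
∸-⊕ : ∀ {m V} n .{{_ : NonZero n}} (c d : Vec ℕ m) → Bounded V d →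
  zipWith _∸_ (c ⊕ n ⊙ replicate m V) d ⊕ d ≡ c ⊕ n ⊙ replicate m V
∸-⊕ n []       []       Vec.[]       = ≡.refl
∸-⊕ {V = V} n (c ∷ cs) (d ∷ ds) (d≤V Vec.∷ ds≤V) =
  cong₂ _∷_ (m∸n+n≡m (≤-trans d≤V (≤-trans (m≤n*m V n) (m≤n+m (n * V) c)))) (∸-⊕ n cs ds ds≤V)

allBounded? : ∀ {p} m L {P : Pred (Vec ℕ m) p} → Decidable P → Dec (∀ c → Bounded L c → P c)
allBounded? zero    L P? = map′ (λ { p [] _ → p }) (λ p → p [] Vec.[]) (P? [])
allBounded? (suc m) L P? = map′
  (λ { p (c ∷ cs) (c≤L Vec.∷ cs≤L) → p (s≤s c≤L) cs cs≤L })
  (λ { p (s≤s c≤L) cs cs≤L → p _ (c≤L Vec.∷ cs≤L) })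
  -- `allUpTo?` tests strict bounds, hence `suc L`.
  (allUpTo? (λ c → allBounded? m L (λ cs → P? (c ∷ cs))) (suc L))

LocalPeriod : ∀ {a m} {A : Set a} → ℕ → (Vec ℕ m → A) → Fin m → ℕ → Set a
LocalPeriod L F i j = ∀ c → Bounded L c → F (updateAt c i (_+ j)) ≡ F c

module _ {a} {A : Set a} (q L : ℕ) where

  -- Descending in steps of `suc j` stays in the window and takes both c and `c % suc q` to their
  -- residues modulo `suc j`, which coincide by divisibility.
  localPeriod-% : (F : ℕ → A) (j : ℕ) → suc j ∣ suc q → (∀ {c} → c ≤ L → F (c + suc j) ≡ F c) →
    ∀ {c} → c ≤ L → F c ≡ F (c % suc q)
  localPeriod-% F j j∣M per {c} c≤L = begin
    F c                       ≡⟨ reduce c≤L ⟩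
    F (c % suc j)             ≡⟨ cong F (m∣n⇒o%n%m≡o%m (suc j) (suc q) c j∣M) ⟨
    F (c % suc q % suc j)     ≡⟨ reduce (≤-trans (m%n≤m c (suc q)) c≤L) ⟨
    F (c % suc q)             ∎
    where
    open ≡.≡-Reasoning
    iterate : ∀ t ρ → ρ + t * suc j ≤ L → F (ρ + t * suc j) ≡ F ρ
    iterate zero    ρ _  = cong F (+-identityʳ ρ)
    iterate (suc t) ρ ≤L = begin
      F (ρ + (suc j + t * suc j))  ≡⟨ cong F shuffle ⟩
      F (ρ + t * suc j + suc j)    ≡⟨ per smaller ⟩
      F (ρ + t * suc j)            ≡⟨ iterate t ρ smaller ⟩
      F ρ                          ∎
      where
      shuffle : ρ + (suc j + t * suc j) ≡ ρ + t * suc j + suc j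
      shuffle = ≡.trans (cong (ρ +_) (+-comm (suc j) _)) (≡.sym (+-assoc ρ _ _))
      smaller : ρ + t * suc j ≤ L
      smaller = ≤-trans (m≤m+n _ (suc j)) (subst (_≤ L) shuffle ≤L)
    reduce : ∀ {c} → c ≤ L → F c ≡ F (c % suc j)
    reduce {c} c≤L = ≡.trans (cong F decompose) (iterate (c / suc j) (c % suc j) (subst (_≤ L) decompose c≤L))
      where
      decompose = m≡m%n+[m/n]*n c (suc j)

  -- Coordinates are reduced in turn; a reduced one has not grown, so the vector is still in the
  -- window for the next.
  localPeriods-residue : ∀ {m} (F : Vec ℕ m → A) →
    (∀ i → ∃ λ j → suc j ∣ suc q × LocalPeriod L F i (suc j)) →
    ∀ {c} → Bounded L c → F c ≡ F (residue q c)
  localPeriods-residue F per Vec.[] = ≡.refl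
  localPeriods-residue F per {c ∷ cs} (c≤L Vec.∷ cs≤L) with per zero
  ... | j , j∣M , perⱼ = ≡.trans
    (localPeriod-% (λ z → F (z ∷ cs)) j j∣M (λ {z} z≤L → perⱼ (z ∷ cs) (z≤L Vec.∷ cs≤L)) c≤L)
    (localPeriods-residue (λ zs → F ((c % suc q) ∷ zs))
      (λ i → map₂ (map₂ (λ p zs zs≤L → p ((c % suc q) ∷ zs) (≤-trans (m%n≤m c (suc q)) c≤L Vec.∷ zs≤L))) (per (suc i)))
      cs≤L)

-- The modulus N! is fixed before any period is found: the window on which periods are tested
-- depends on it, so it has to serve all candidates at once.
commonMultiple : ∀ N → ∃ λ q → ∀ {j} → j < N → suc j ∣ suc q
commonMultiple N = pred (N !) , λ {j} j<N →
  subst (suc j ∣_) (≡.sym (suc-pred (N !) {{N !≢0}})) (∣-trans (m∣m*n (j !)) (m≤n⇒m!∣n! j<N))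

unit : ∀ {m} → Fin m → Vec ℕ m
unit zero    = 1 ∷ 𝟎
unit (suc i) = 0 ∷ unit i

Bounded-unit : ∀ {m} (i : Fin m) → Bounded 1 (unit i)
Bounded-unit zero    = ≤-refl Vec.∷ Bounded-mono z≤n (Bounded-replicate _)
Bounded-unit (suc i) = z≤n Vec.∷ Bounded-unit i

-- Here h is the size of the box, s that of the reflected set, p the order of the group of periods,
-- t the number of cosets representing the reflected set and u the number of generators in one
-- coset.
cardinality-bound : ∀ {r n h s p t u} → 0 < r → 0 < p →
  r * r * n * p ≤ h * u → h ≤ r * r * s → s ≤ t * p → n ≤ t * u
cardinality-bound {r} {n} {h} {s} {p} {t} {u} 0<r 0<p rrnp≤hu h≤rrs s≤tp = *-cancelˡ-≤ (r * r * p) (begin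
  r * r * p * n          ≡⟨ rearrange₁ (r * r) p n ⟩
  r * r * n * p          ≤⟨ rrnp≤hu ⟩
  h * u                  ≤⟨ *-monoˡ-≤ u h≤rrs ⟩
  r * r * s * u          ≤⟨ *-monoˡ-≤ u (*-monoʳ-≤ (r * r) s≤tp) ⟩
  r * r * (t * p) * u    ≡⟨ rearrange₂ (r * r) p t u ⟩
  r * r * p * (t * u)    ∎)
  where
  open ≤-Reasoning
  instance
    r≢0 : NonZero r
    r≢0 = >-nonZero 0<r
    p≢0 : NonZero p
    p≢0 = >-nonZero 0<p
    rr≢0 : NonZero (r * r)
    rr≢0 = m*n≢0 r r
    rrp≢0 : NonZero (r * r * p)
    rrp≢0 = m*n≢0 (r * r) p
  rearrange₁ : ∀ s p n → s * p * n ≡ s * n * p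
  rearrange₁ = solve-∀
  rearrange₂ : ∀ s p t u → s * (t * p) * u ≡ s * p * (t * u)
  rearrange₂ = solve-∀

-- For the period M = suc q: a bound on the coordinates of the displacements
-- from the centre in fromPeriods ...
displacementBound : ℕ → ℕ
displacementBound q = suc q + 1 + q * suc q

-- ... and on those of all vectors whose colours are compared there.
windowBound : ℕ → ℕ
windowBound q = suc q + suc q * displacementBound q + displacementBound q

-- Linear combinations in an Abelian group.

module _ {c ℓ : Level} (G : AbelianGroup c ℓ) where
  open AbelianGroup G
  open import Algebra.Properties.Monoid.Mult monoid renaming (_×_ to _·_)
  open import Algebra.Properties.Group group using (∙-cancelˡ; ∙-cancelʳ; identityʳ-unique; //-rightDividesʳ)
  import Relation.Binary.Reasoning.Setoid setoid as ≈-Reasoning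

  -- A reflection is recognised by a sum, so that combinations with natural coefficients never have
  -- to express an inverse.
  reflectAt-unique : ∀ {g x y} → y ∙ x ≈ g ∙ g → reflectAt G g x ≈ y
  reflectAt-unique {g} {x} {y} yx≈gg = trans (∙-congʳ (sym yx≈gg)) (//-rightDividesʳ x y)

  linComb : ∀ {m} → (Fin m → Carrier) → Vec ℕ m → Carrier
  linComb e []       = ε
  linComb e (c ∷ cs) = c · e zero ∙ linComb (e ∘ suc) cs

  interchange : ∀ u v x y → (u ∙ v) ∙ (x ∙ y) ≈ (u ∙ x) ∙ (v ∙ y)
  interchange u v x y = begin
    (u ∙ v) ∙ (x ∙ y)  ≈⟨ assoc u v _ ⟩
    u ∙ (v ∙ (x ∙ y))  ≈⟨ ∙-congˡ (assoc v x y) ⟨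
    u ∙ ((v ∙ x) ∙ y)  ≈⟨ ∙-congˡ (∙-congʳ (comm v x)) ⟩
    u ∙ ((x ∙ v) ∙ y)  ≈⟨ ∙-congˡ (assoc x v y) ⟩
    u ∙ (x ∙ (v ∙ y))  ≈⟨ assoc u x _ ⟨
    (u ∙ x) ∙ (v ∙ y)  ∎
    where open ≈-Reasoning

  linComb-⊕ : ∀ {m} (e : Fin m → Carrier) x y → linComb e (x ⊕ y) ≈ linComb e x ∙ linComb e y
  linComb-⊕ e []       []       = sym (identityˡ ε)
  linComb-⊕ e (x ∷ xs) (y ∷ ys) =
    trans (∙-cong (×-homo-+ (e zero) x y) (linComb-⊕ (e ∘ suc) xs ys)) (interchange _ _ _ _)

  linComb-𝟎 : ∀ {m} (e : Fin m → Carrier) → linComb e 𝟎 ≈ ε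
  linComb-𝟎 {zero}  e = refl
  linComb-𝟎 {suc m} e = trans (identityˡ _) (linComb-𝟎 (e ∘ suc))

  linComb-unit : ∀ {m} (e : Fin m → Carrier) i → linComb e (unit i) ≈ e i
  linComb-unit e zero    = trans (∙-cong (×-homo-1 (e zero)) (linComb-𝟎 (e ∘ suc))) (identityʳ _)
  linComb-unit e (suc i) = trans (identityˡ _) (linComb-unit (e ∘ suc) i)

  linComb-updateAt : ∀ {m} (e : Fin m → Carrier) c i j →
    linComb e (updateAt c i (_+ j)) ≈ linComb e c ∙ j · e i
  linComb-updateAt e (c ∷ cs) zero j = begin
    (c + j) · e zero ∙ S           ≈⟨ ∙-congʳ (×-homo-+ (e zero) c j) ⟩
    (c · e zero ∙ j · e zero) ∙ S  ≈⟨ assoc _ _ _ ⟩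
    c · e zero ∙ (j · e zero ∙ S)  ≈⟨ ∙-congˡ (comm _ S) ⟩
    c · e zero ∙ (S ∙ j · e zero)  ≈⟨ assoc _ _ _ ⟨
    (c · e zero ∙ S) ∙ j · e zero  ∎
    where
    open ≈-Reasoning
    S = linComb (e ∘ suc) cs
  linComb-updateAt e (c ∷ cs) (suc i) j =
    trans (∙-congˡ (linComb-updateAt (e ∘ suc) cs i j)) (sym (assoc _ _ _))

  module _ {d N} (order : ∀ {j} → j < N → ¬ suc j · d ≈ ε) where

    -- If the two multiples agreed, the difference y - x, between 1 and `N`, would annihilate `d`.
    <⇒·≉ : ∀ {x y} → x < y → y ≤ N → ¬ x · d ≈ y · d
    <⇒·≉ {x} x<y y≤N xd≈yd with k , ≡.refl ← m≤n⇒∃[o]m+o≡n x<y =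
      order (≤-trans (s≤s (m≤n+m k x)) y≤N) (identityʳ-unique (x · d) (suc k · d) (begin
        x · d ∙ suc k · d  ≈⟨ ×-homo-+ d x (suc k) ⟨
        (x + suc k) · d    ≈⟨ ×-congˡ (+-suc x k) ⟩
        suc (x + k) · d    ≈⟨ xd≈yd ⟨
        x · d              ∎))
      where open ≈-Reasoning

    ·-injective : ∀ {x y} → x ≤ N → y ≤ N → x · d ≈ y · d → x ≡ y
    ·-injective {x} {y} x≤N y≤N xd≈yd with <-cmp x y
    ... | tri≈ _ x≡y _ = x≡y
    ... | tri< x<y _ _ = contradiction xd≈yd (<⇒·≉ x<y y≤N)
    ... | tri> _ _ y<x = contradiction (sym xd≈yd) (<⇒·≉ y<x x≤N)

  -- Construction of the monochromatic symmetric set.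

  module _ {r : ℕ} (χ : Carrier → Fin r) (χ-cong : IsColoring G χ) where

    MonochromaticSymmetric : ℕ → Set _
    MonochromaticSymmetric n = Σ (Carrier → Set ℓ) λ A →
      Monochromatic G χ A × Symmetric G A × SubsetCardAtLeast G A n

    0<r : 0 < r
    0<r = ≤-trans (s≤s z≤n) (Fin.toℕ<n (χ ε))

    -- The set consists of all x such that x and its reflection have colour `k`. It is symmetric
    -- since reflection is an involution; the points `z i` only witness its size.
    monochromaticSymmetric : ∀ g k {n m} → n ≤ m → (z : Fin m → Carrier) → (∀ i → χ (z i) ≡ k) →
      (∀ i → χ (reflectAt G g (z i)) ≡ k) → (∀ i j → z i ≈ z j → i ≡ j) → MonochromaticSymmetric n
    monochromaticSymmetric g k n≤m z χz χrz z-inj =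
      S , (k , λ x → proj₁ ∘ lower) , (g , λ x → mk⇔ (forward x) (backward x)) ,
      (λ i → z (inject≤ i n≤m)) , (λ i → lift (χz _ , χrz _)) ,
      λ i j zi≈zj → Fin.inject≤-injective n≤m n≤m i j (z-inj _ _ zi≈zj)
      where
      S : Carrier → Set ℓ
      S x = Lift ℓ (χ x ≡ k × χ (reflectAt G g x) ≡ k)
      involutive : ∀ x → reflectAt G g (reflectAt G g x) ≈ x
      involutive x = reflectAt-unique (begin
        x ∙ (g ∙ g ∙ x ⁻¹)    ≈⟨ comm x _ ⟩
        (g ∙ g ∙ x ⁻¹) ∙ x    ≈⟨ assoc _ _ _ ⟩
        g ∙ g ∙ (x ⁻¹ ∙ x)    ≈⟨ ∙-congˡ (inverseˡ x) ⟩
        g ∙ g ∙ ε             ≈⟨ identityʳ _ ⟩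
        g ∙ g                 ∎)
        where open ≈-Reasoning
      reflected : ∀ {x} → S x → S (reflectAt G g x)
      reflected {x} (lift (χx , χrx)) = lift (χrx , ≡.trans (χ-cong (involutive x)) χx)
      forward : ∀ x → S x → ∃ λ a → S a × x ≈ reflectAt G g a
      forward x Sx = reflectAt G g x , reflected Sx , sym (involutive x)
      backward : ∀ x → (∃ λ a → S a × x ≈ reflectAt G g a) → S x
      backward x (a , Sa , x≈ra) with reflected Sa
      ... | lift (χra , χrra) = lift (≡.trans (χ-cong x≈ra) χra ,
              ≡.trans (χ-cong (∙-congˡ (⁻¹-cong x≈ra))) χrra)

    fromProgression : ∀ n d → (∀ {j} → j < 2 * (2 * (r * r * n)) → ¬ suc j · d ≈ ε) → MonochromaticSymmetric n
    fromProgression n d order with mirrored-interval (λ x → χ ((2 * x) · d)) 0<r n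
    ... | s , k , n≤ = monochromaticSymmetric (s · d) k n≤ z
            (λ i → proj₁ (proj₂ (mirrored i)))
            (λ i → ≡.trans (χ-cong (reflectAt-unique (reflection i))) (proj₂ (proj₂ (mirrored i))))
            injective
      where
      K = 2 * (r * r * n)
      -- Only even multiples of `d` are used: `s` may be odd, but 2x and 2(s - x) always have the
      -- midpoint s. This doubles the range on which `order` is needed.
      f : ℕ → Fin r
      f x = χ ((2 * x) · d)
      xs = filter (mirrored? f s k) (upTo K)
      z : Fin (length xs) → Carrier
      z i = (2 * lookup xs i) · d
      member : ∀ i → lookup xs i ∈ upTo K × Mirrored f s k (lookup xs i)
      member i = ∈-filter⁻ (mirrored? f s k) (∈-lookup i)
      mirrored : ∀ i → Mirrored f s k (lookup xs i)
      mirrored i = proj₂ (member i)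
      reflection : ∀ i → (2 * (s ∸ lookup xs i)) · d ∙ z i ≈ s · d ∙ s · d
      reflection i = begin
        (2 * (s ∸ x)) · d ∙ (2 * x) · d   ≈⟨ ×-homo-+ d (2 * (s ∸ x)) (2 * x) ⟨
        (2 * (s ∸ x) + 2 * x) · d         ≈⟨ ×-congˡ doubled ⟩
        (s + s) · d                       ≈⟨ ×-homo-+ d s s ⟩
        s · d ∙ s · d                     ∎
        where
        open ≈-Reasoning
        x = lookup xs i
        doubled : 2 * (s ∸ x) + 2 * x ≡ s + s
        doubled = ≡.trans (≡.sym (*-distribˡ-+ 2 (s ∸ x) x))
          (≡.trans (cong (2 *_) (m∸n+n≡m (proj₁ (mirrored i)))) (cong (s +_) (+-identityʳ s)))
      bound : ∀ i → 2 * lookup xs i ≤ 2 * K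
      bound i = *-monoʳ-≤ 2 (<⇒≤ (∈-upTo⁻ (proj₁ (member i))))
      injective : ∀ i j → z i ≈ z j → i ≡ j
      injective i j zi≈zj = lookup-injective {R = _≡_} ≡.sym (Unique.filter⁺ (mirrored? f s k) (Unique.upTo⁺ K)) i j
        (*-cancelˡ-≡ _ _ 2 (·-injective order (bound i) (bound j) zi≈zj))

    module _ (n : ℕ) (e : Fin (r * r * n) → Carrier) (e-injective : ∀ i j → e i ≈ e j → i ≡ j) (q : ℕ) where

      private
        dim = r * r * n
        M = suc q
        V = displacementBound q
        L = windowBound q

      fromPeriods : (∀ i → ∃ λ j → suc j ∣ M × LocalPeriod L (χ ∘ linComb e) i (suc j)) → MonochromaticSymmetric n
      fromPeriods periods = result
        where
        φ = linComb e

        -- Periodic by construction; it is compared with the colouring of G only inside the window,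
        -- where `periods` makes the two agree.
        κ : Vec ℕ dim → Fin r
        κ = χ ∘ φ ∘ residue q

        open PeriodicColouring q κ (λ x y → cong (χ ∘ φ) (residue-⊕ q x y))

        χφ≡κ : ∀ {x} → Bounded L x → χ (φ x) ≡ κ x
        χφ≡κ = localPeriods-residue q L (χ ∘ φ) periods

        dense = denseReflection 0<r
        g = proj₁ dense
        k = proj₁ (proj₂ dense)
        g∈box = proj₁ (proj₂ (proj₂ dense))

        reps = reflectedRepresentatives g k
        R = proj₁ reps
        R-distinct = proj₁ (proj₂ reps)
        R-member = proj₁ (proj₂ (proj₂ reps))

        class = largeClass unit
        x = proj₁ class
        I = proj₁ (proj₂ class)
        x∈box = proj₁ (proj₂ (proj₂ class))
        I-unique = proj₁ (proj₂ (proj₂ (proj₂ class)))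
        I-member = proj₁ (proj₂ (proj₂ (proj₂ (proj₂ class))))

        n≤ : n ≤ length R * length I
        n≤ = cardinality-bound {r} {t = length R} {u = length I} 0<r 0<classSize
          (proj₂ (proj₂ (proj₂ (proj₂ (proj₂ class)))))
          (proj₂ (proj₂ (proj₂ dense)))
          (proj₂ (proj₂ (proj₂ reps)))

        -- g moved by a period, so that the subtraction in z⁻ never truncates.
        g′ : Vec ℕ dim
        g′ = g ⊕ M ⊙ replicate dim V

        -- The chosen generators lie in the class of `x`, so adding one of them and then -x, in the
        -- form `q ⊙ x`, does not leave the class of `lookup R a`.
        v : Fin (length R) → Fin (length I) → Vec ℕ dim
        v a i = (lookup R a ⊕ unit (lookup I i)) ⊕ q ⊙ x

        v~ : ∀ a i → v a i ~ lookup R a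
        v~ a i = ~-trans (~-⊕ʳ (q ⊙ x) (~-⊕ˡ (lookup R a) (I-member (∈-lookup i))))
          (~-trans (≡⇒~ (⊕-suc-⊙ q (lookup R a) x)) (~-period (lookup R a) x))

        Bounded-v : ∀ a i → Bounded V (v a i)
        Bounded-v a i = Bounded-⊕
          (Bounded-⊕ (∈-box⁻ q (proj₁ (R-member (∈-lookup a)))) (Bounded-unit (lookup I i)))
          (Bounded-⊙ q (∈-box⁻ q x∈box))

        Bounded-g′ : Bounded (M + M * V) g′
        Bounded-g′ = Bounded-⊕ (∈-box⁻ q g∈box) (Bounded-⊙ M (Bounded-replicate dim))

        v-reflected : ∀ a i → Reflected g k (v a i)
        v-reflected a i = Reflected-resp-~ {g} (~-sym (v~ a i)) (proj₂ (R-member (∈-lookup a)))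

        z z⁻ : Fin (length R) → Fin (length I) → Vec ℕ dim
        z  a i = g′ ⊕ v a i
        z⁻ a i = zipWith _∸_ g′ (v a i)

        z⁻⊕v : ∀ a i → z⁻ a i ⊕ v a i ≡ g′
        z⁻⊕v a i = ∸-⊕ M g (v a i) (Bounded-v a i)

        χz : ∀ a i → χ (φ (z a i)) ≡ k
        χz a i = ≡.trans (χφ≡κ (Bounded-⊕ Bounded-g′ (Bounded-v a i)))
          (≡.trans (_~_.agree (~-period g _) (v a i)) (proj₂ (v-reflected a i)))

        -- Adding the period `M ⊙ v a i` and using one copy of `v a i` to restore `g′` leaves g′ +
        -- `q ⊙ v a i`, to which the first half of `v-reflected` applies.
        κz⁻ : ∀ a i → κ (z⁻ a i) ≡ k
        κz⁻ a i = begin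
          κ (z⁻ a i)                           ≡⟨ ~⇒κ (~-period (z⁻ a i) (v a i)) ⟨
          κ (z⁻ a i ⊕ M ⊙ v a i)               ≡⟨ cong κ (⊕-suc-⊙ q (z⁻ a i) (v a i)) ⟨
          κ (z⁻ a i ⊕ v a i ⊕ q ⊙ v a i)       ≡⟨ cong (λ w → κ (w ⊕ q ⊙ v a i)) (z⁻⊕v a i) ⟩
          κ (g′ ⊕ q ⊙ v a i)                   ≡⟨ _~_.agree (~-period g _) (q ⊙ v a i) ⟩
          κ (g ⊕ q ⊙ v a i)                    ≡⟨ proj₁ (v-reflected a i) ⟩
          k                                    ∎
          where open ≡.≡-Reasoning

        reflection : ∀ a i → φ (z⁻ a i) ∙ φ (z a i) ≈ φ g′ ∙ φ g′
        reflection a i = begin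
          φ (z⁻ a i) ∙ φ (z a i)   ≈⟨ linComb-⊕ e (z⁻ a i) (z a i) ⟨
          φ (z⁻ a i ⊕ z a i)
            ≡⟨ cong φ (≡.trans (cong (z⁻ a i ⊕_) (⊕-comm g′ (v a i)))
                 (≡.trans (≡.sym (⊕-assoc (z⁻ a i) (v a i) g′)) (cong (_⊕ g′) (z⁻⊕v a i)))) ⟩
          φ (g′ ⊕ g′)              ≈⟨ linComb-⊕ e g′ g′ ⟩
          φ g′ ∙ φ g′              ∎
          where open ≈-Reasoning

        χz⁻ : ∀ a i → χ (reflectAt G (φ g′) (φ (z a i))) ≡ k
        χz⁻ a i = ≡.trans (χ-cong (reflectAt-unique (reflection a i)))
          (≡.trans (χφ≡κ (Bounded-mono (m≤m+n _ V) (Bounded-∸ (v a i) Bounded-g′))) (κz⁻ a i))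

        ⊕-cancelˡ : ∀ w y y′ → φ (w ⊕ y) ≈ φ (w ⊕ y′) → φ y ≈ φ y′
        ⊕-cancelˡ w y y′ eq = ∙-cancelˡ (φ w) _ _
          (trans (sym (linComb-⊕ e w y)) (trans eq (linComb-⊕ e w y′)))

        ⊕-cancelʳ : ∀ w y y′ → φ (y ⊕ w) ≈ φ (y′ ⊕ w) → φ y ≈ φ y′
        ⊕-cancelʳ w y y′ eq = ∙-cancelʳ (φ w) _ _
          (trans (sym (linComb-⊕ e y w)) (trans eq (linComb-⊕ e y′ w)))

        -- Equal points of G have equally coloured translates. All translates by the box stay in the
        -- window, and by `~-box` these determine the class.
        φv≈⇒~ : ∀ {a b i j} → φ (v a i) ≈ φ (v b j) → v a i ~ v b j
        φv≈⇒~ {a} {b} {i} {j} eq = ~-box λ {y} y∈ →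
          ≡.trans (≡.sym (χφ≡κ (bound a i y∈)))
            (≡.trans (χ-cong (trans (linComb-⊕ e (v a i) y) (trans (∙-congʳ eq) (sym (linComb-⊕ e (v b j) y)))))
              (χφ≡κ (bound b j y∈)))
          where
          bound : ∀ a i {y} → y ∈ box q dim → Bounded L (v a i ⊕ y)
          bound a i y∈ = Bounded-mono
            (≤-trans (≤-reflexive (+-comm V M)) (+-monoˡ-≤ V (m≤m+n M (M * V))))
            (Bounded-⊕ (Bounded-v a i) (∈-box⁻ q y∈))

        sameRepresentative : ∀ {a b i j} → φ (v a i) ≈ φ (v b j) → a ≡ b
        sameRepresentative {a} {b} {i} {j} eq = lookup-injective {R = _~_} ~-sym R-distinct a b
          (~-trans (~-sym (v~ a i)) (~-trans (φv≈⇒~ {a} {b} {i} {j} eq) (v~ b j)))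

        -- With the representative fixed, both summands shared by the two points cancel, leaving the
        -- images of two generators under `e`.
        sameGenerator : ∀ {a i j} → φ (v a i) ≈ φ (v a j) → i ≡ j
        sameGenerator {a} {i} {j} eq = lookup-injective {R = _≡_} ≡.sym I-unique i j
          (e-injective _ _ (trans (sym (linComb-unit e _))
            (trans (⊕-cancelˡ (lookup R a) _ _ (⊕-cancelʳ (q ⊙ x)
              (lookup R a ⊕ unit (lookup I i)) (lookup R a ⊕ unit (lookup I j)) eq)) (linComb-unit e _))))

        z-injective : ∀ {a b i j} → φ (z a i) ≈ φ (z b j) → combine a i ≡ combine b j
        z-injective {a} {b} {i} {j} eq with sameRepresentative {a} {b} {i} {j} (⊕-cancelˡ g′ (v a i) (v b j) eq)
        ... | ≡.refl = cong (combine a) (sameGenerator {a} {i} {j} (⊕-cancelˡ g′ (v a i) (v a j) eq))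

        decode = remQuot {length R} (length I)

        result : MonochromaticSymmetric n
        result = monochromaticSymmetric (φ g′) k n≤ (λ t → φ (uncurry z (decode t)))
          (λ t → uncurry χz (decode t)) (λ t → uncurry χz⁻ (decode t))
          λ s t eq → ≡.trans (≡.sym (Fin.combine-remQuot {length R} (length I) s))
            (≡.trans (z-injective eq) (Fin.combine-remQuot {length R} (length I) t))

    fromInjection : ∀ n → CardAtLeast G (r * r * n) → MonochromaticSymmetric n
    fromInjection n (e , e-injective) with commonMultiple (2 * (2 * (r * r * n)))
    ... | q , multiple = decide (Fin.all? shortPeriod?)
      where
      N = 2 * (2 * (r * r * n))

      ShortPeriod : Fin (r * r * n) → Set
      ShortPeriod i = ∃ λ j → j < N × LocalPeriod (windowBound q) (χ ∘ linComb e) i (suc j)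

      shortPeriod? : Decidable ShortPeriod
      shortPeriod? i = anyUpTo? (λ j → allBounded? _ (windowBound q)
        (λ c → χ (linComb e (updateAt c i (_+ suc j))) Fin.≟ χ (linComb e c))) N

      decide : Dec (∀ i → ShortPeriod i) → MonochromaticSymmetric n
      decide (yes periods) = fromPeriods n e e-injective q (λ i → map₂ (map₁ multiple) (periods i))
      decide (no ¬periods) with Fin.¬∀⟶∃¬ _ ShortPeriod shortPeriod? ¬periods
      -- A vanishing multiple of `e i` would be a period of the pulled-back colouring everywhere, so
      -- the failed test bounds the order of `e i` from below.
      ... | i , ¬period = fromProgression n (e i) λ {j} j<N je≈ε → ¬period (j , j<N , λ c _ →
              χ-cong (trans (linComb-updateAt e c i (suc j)) (trans (∙-congˡ je≈ε) (identityʳ _))))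

theorem1p4 : {c ℓ : Level} (r n : ℕ) (G : AbelianGroup c ℓ) →
    CardAtLeast G (r * r * n) →
    (χ : AbelianGroup.Carrier G → Fin r) → IsColoring G χ →
    Σ (AbelianGroup.Carrier G → Set ℓ) λ A →
    Monochromatic G χ A × Symmetric G A × SubsetCardAtLeast G A n
theorem1p4 r n G card χ χ-cong = fromInjection G χ χ-cong n card
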